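{- For every integer $n\ge 0$ the following identities hold: (i) $\displaystyle\sum_{i=0}^{n}B_i(t)\,U_{n-i}\!\left(-\tfrac{t}{2}\right)=\begin{cases}0 & \text{if } n \text{ is even},\\ B_{\frac{n+1}{2}}(t) & \text{if } n \text{ is odd};\end{cases}$ (ii) $\displaystyle\sum_{i=0}^{n}B_i(t)B_{n-i}(-t)=\begin{cases}B_{\frac{n}{2}}(2-t^{2}) & \text{if } n \text{ is even},\\ 0 & \text{if } n \text{ is odd};\end{cases}$ (iii) as an identity of rational functions of $t$, $$\frac{t^{2}}{t^{4}-1}\sum_{i=0}^{n}\left(t^{2i}-\frac{1}{t^{2i}}\right)B_{n-i}\!\left(-t^{2}-\frac{1}{t^{2}}\right)=\begin{cases}B_{\frac{n}{2}}\!\left(-t^{2}-\frac{1}{t^{2}}\right) & \text{if } n \text{ is even},\\ 0 & \text{if } n \text{ is odd}.\end{cases}$$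
   Context: The Stern polynomials $B_n(t)\in\mathbb{Z}[t]$, $n\ge 0$, are defined by $B_0(t)=0$, $B_1(t)=1$, $B_{2n}(t)=tB_n(t)$ and $B_{2n+1}(t)=B_n(t)+B_{n+1}(t)$ for $n\ge 1$. $U_n(t)$ denotes the Chebyshev polynomial of the second kind, determined by $\frac{1}{1-2tx+x^{2}}=\sum_{n\ge 0}U_n(t)x^{n}$. -}

module Defs where

open import Algebra.Bundles using (CommutativeRing; RawRing)
open import Algebra.Structures using (IsCommutativeRing)
open import Algebra.Morphism.Structures using (IsRingMonomorphism)
import Algebra.Morphism.RingMonomorphism as RingMonomorphism
import Algebra.Properties.CommutativeMonoid.Sum as Sum
import Algebra.Properties.Group as GroupProperties
import Algebra.Properties.Ring as RingProperties
import Algebra.Properties.Semiring.Exp as Exp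
import Algebra.Properties.Semiring.Mult as Mult
import Algebra.Solver.Ring.NaturalCoefficients.Default as Solver
open import Data.Bool.Base using (if_then_else_; true; false)
open import Data.Empty using (⊥-elim)
open import Data.Fin.Base using (Fin; zero; suc; toℕ)
open import Data.Integer.Base as ℤ using (ℤ; +_; -[1+_])
import Data.Integer.Properties as ℤₚ
open import Data.List.Base using (List; []; _∷_; map)
open import Data.Nat.Base as ℕ using (ℕ; zero; suc; _<_; ⌊_/2⌋; ⌈_/2⌉; s≤s; z≤n)
open import Data.Nat.Divisibility using (_∣?_; _∣_; m∣m*n; ∣m+n∣m⇒∣n; ∣⇒≤)
open import Data.Nat.Induction using (<-wellFounded)
import Data.Nat.Properties as ℕₚ
open import Data.Product.Base using (_,_)
open import Data.Rational.Base as ℚ using (0ℚ; 1ℚ)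
import Data.Rational.Properties as ℚₚ
open import Data.Sum.Base using (_⊎_; inj₁; inj₂; [_,_]′; map₁)
open import Data.Vec.Base using (Vec; []; _∷_; head; lookup)
open import Function.Base using (_∘_)
open import Induction.WellFounded using (Acc; acc)
open import Level using (Level; _⊔_)
open import Relation.Binary.Definitions using (Decidable)
open import Relation.Binary.PropositionalEquality as ≡ using (_≡_)
import Relation.Binary.Reasoning.Setoid as SetoidReasoning
open import Relation.Nullary using (¬_; yes; no; does)
open import Relation.Nullary.Decidable using (dec-true; dec-false)

private variable
  c ℓ : Level

module PowerSeries (R : CommutativeRing c ℓ) where
  private module R = CommutativeRing R
  open R using (Carrier)
  open Sum R.+-commutativeMonoid using (sum; ∑-distrib-+; sum-cong-≋)
  open SetoidReasoning R.setoid

  Series : Set c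
  Series = ℕ → Carrier

  record _≈_ (f g : Series) : Set ℓ where
    constructor coeffwise
    field at : ∀ n → f n R.≈ g n
  open _≈_ public

  infix  4 _≈_
  infixl 6 _+_
  infixl 7 _*_
  infix  8 -_

  _+_ : Series → Series → Series
  (f + g) n = f n R.+ g n

  -_ : Series → Series
  (- f) n = R.- f n

  0# : Series
  0# n = R.0#

  1# : Series
  1# zero    = R.1#
  1# (suc n) = R.0#

  _*_ : Series → Series → Series
  (f * g) n = sum {suc n} λ i → f (toℕ i) R.* g (n ℕ.∸ toℕ i)

  private
    tail : Series → Series
    tail f n = f (suc n)

    scale : Carrier → Series → Series
    scale a f n = a R.* f n

    *-cong : ∀ {f f′ g g′} → (∀ n → f n R.≈ f′ n) → (∀ n → g n R.≈ g′ n) →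
             ∀ n → (f * g) n R.≈ (f′ * g′) n
    *-cong p q n = sum-cong-≋ {suc n} λ i → R.*-cong (p (toℕ i)) (q (n ℕ.∸ toℕ i))

    zeroˡ : ∀ g n → (0# * g) n R.≈ R.0#
    zeroˡ g zero    = R.trans (R.+-identityʳ _) (R.zeroˡ _)
    zeroˡ g (suc n) = R.trans (R.+-cong (R.zeroˡ _) (zeroˡ g n)) (R.+-identityʳ _)

    identityˡ : ∀ g n → (1# * g) n R.≈ g n
    identityˡ g zero    = R.trans (R.+-identityʳ _) (R.*-identityˡ _)
    identityˡ g (suc n) =
      R.trans (R.+-cong (R.*-identityˡ _) (zeroˡ g n)) (R.+-identityʳ _)

    distribʳ : ∀ h f g n → ((f + g) * h) n R.≈ (f * h) n R.+ (g * h) n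
    distribʳ h f g n = R.trans
      (sum-cong-≋ {suc n} λ i → R.distribʳ (h (n ℕ.∸ toℕ i)) (f (toℕ i)) (g (toℕ i)))
      (∑-distrib-+ {suc n} (λ i → f (toℕ i) R.* h (n ℕ.∸ toℕ i))
                           (λ i → g (toℕ i) R.* h (n ℕ.∸ toℕ i)))

    last : ∀ f g n → (f * g) (suc n) R.≈ (f * tail g) n R.+ f (suc n) R.* g 0
    last f g zero = R.trans (R.+-congˡ (R.+-identityʳ _)) (R.+-congʳ (R.sym (R.+-identityʳ _)))
    last f g (suc n) = R.trans (R.+-congˡ (last (tail f) g n)) (R.sym (R.+-assoc _ _ _))

    comm : ∀ f g n → (f * g) n R.≈ (g * f) n
    comm f g zero    = R.+-congʳ (R.*-comm _ _)
    comm f g (suc n) = begin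
      f 0 R.* g (suc n) R.+ (tail f * g) n ≈⟨ R.+-cong (R.*-comm _ _) (comm (tail f) g n) ⟩
      g (suc n) R.* f 0 R.+ (g * tail f) n ≈⟨ R.+-comm _ _ ⟩
      (g * tail f) n R.+ g (suc n) R.* f 0 ≈⟨ last g f n ⟨
      (g * f) (suc n)                      ∎

    scale-* : ∀ a f g n → (scale a f * g) n R.≈ a R.* (f * g) n
    scale-* a f g zero = begin
      a R.* f 0 R.* g 0 R.+ R.0#     ≈⟨ R.+-identityʳ _ ⟩
      a R.* f 0 R.* g 0              ≈⟨ R.*-assoc _ _ _ ⟩
      a R.* (f 0 R.* g 0)            ≈⟨ R.*-congˡ (R.+-identityʳ _) ⟨
      a R.* (f 0 R.* g 0 R.+ R.0#)   ∎
    scale-* a f g (suc n) = begin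
      a R.* f 0 R.* g (suc n) R.+ (scale a (tail f) * g) n
        ≈⟨ R.+-cong (R.*-assoc _ _ _) (scale-* a (tail f) g n) ⟩
      a R.* (f 0 R.* g (suc n)) R.+ a R.* (tail f * g) n
        ≈⟨ R.distribˡ _ _ _ ⟨
      a R.* (f * g) (suc n) ∎

    assoc : ∀ f g h n → ((f * g) * h) n R.≈ (f * (g * h)) n
    assoc f g h zero = R.+-congʳ (begin
      (f 0 R.* g 0 R.+ R.0#) R.* h 0 ≈⟨ R.*-congʳ (R.+-identityʳ _) ⟩
      f 0 R.* g 0 R.* h 0            ≈⟨ R.*-assoc _ _ _ ⟩
      f 0 R.* (g 0 R.* h 0)          ≈⟨ R.*-congˡ (R.+-identityʳ _) ⟨
      f 0 R.* (g 0 R.* h 0 R.+ R.0#) ∎)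
    assoc f g h (suc n) = begin
      (f 0 R.* g 0 R.+ R.0#) R.* h (suc n) R.+ ((scale (f 0) (tail g) + tail f * g) * h) n
        ≈⟨ R.+-cong (R.trans (R.*-congʳ (R.+-identityʳ _)) (R.*-assoc _ _ _))
                    (R.trans (distribʳ h (scale (f 0) (tail g)) (tail f * g) n)
                             (R.+-cong (scale-* (f 0) (tail g) h n) (assoc (tail f) g h n))) ⟩
      f 0 R.* (g 0 R.* h (suc n)) R.+ (f 0 R.* (tail g * h) n R.+ (tail f * (g * h)) n)
        ≈⟨ R.+-assoc _ _ _ ⟨
      f 0 R.* (g 0 R.* h (suc n)) R.+ f 0 R.* (tail g * h) n R.+ (tail f * (g * h)) n
        ≈⟨ R.+-congʳ (R.distribˡ _ _ _) ⟨
      (f * (g * h)) (suc n) ∎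

  isCommutativeRing : IsCommutativeRing _≈_ _+_ _*_ -_ 0# 1#
  isCommutativeRing = record
    { isRing = record
      { +-isAbelianGroup = record
        { isGroup = record
          { isMonoid = record
            { isSemigroup = record
              { isMagma = record
                { isEquivalence = record
                  { refl  = coeffwise λ _ → R.refl
                  ; sym   = λ p → coeffwise λ n → R.sym (at p n)
                  ; trans = λ p q → coeffwise λ n → R.trans (at p n) (at q n)
                  }
                ; ∙-cong = λ p q → coeffwise λ n → R.+-cong (at p n) (at q n)
                }
              ; assoc = λ f g h → coeffwise λ n → R.+-assoc (f n) (g n) (h n)
              }
            ; identity = (λ f → coeffwise λ n → R.+-identityˡ (f n))
                       , (λ f → coeffwise λ n → R.+-identityʳ (f n))
            }
          ; inverse = (λ f → coeffwise λ n → R.-‿inverseˡ (f n))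
                    , (λ f → coeffwise λ n → R.-‿inverseʳ (f n))
          ; ⁻¹-cong = λ p → coeffwise λ n → R.-‿cong (at p n)
          }
        ; comm = λ f g → coeffwise λ n → R.+-comm (f n) (g n)
        }
      ; *-cong     = λ p q → coeffwise (*-cong (at p) (at q))
      ; *-assoc    = λ f g h → coeffwise (assoc f g h)
      ; *-identity = (λ f → coeffwise (identityˡ f))
                   , (λ f → coeffwise λ n → R.trans (comm f 1# n) (identityˡ f n))
      ; distrib    = (λ f g h → coeffwise λ n → begin
                        (f * (g + h)) n            ≈⟨ comm f (g + h) n ⟩
                        ((g + h) * f) n            ≈⟨ distribʳ f g h n ⟩
                        (g * f) n R.+ (h * f) n    ≈⟨ R.+-cong (comm g f n) (comm h f n) ⟩
                        (f * g) n R.+ (f * h) n    ∎)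
                   , (λ h f g → coeffwise (distribʳ h f g))
      }
    ; *-comm = λ f g → coeffwise (comm f g)
    }

  commutativeRing : CommutativeRing c ℓ
  commutativeRing = record { isCommutativeRing = isCommutativeRing }

  -- The coefficients g 0, …, g n of g = 1/f in reverse order, computed
  -- from g (n + 1) = - ∑ᵢ f (i + 1) g (n - i).
  reciprocalCoeffs : Series → ∀ n → Vec Carrier (suc n)
  reciprocalCoeffs f zero    = R.1# ∷ []
  reciprocalCoeffs f (suc n) = (R.- sum λ i → f (suc (toℕ i)) R.* lookup gs i) ∷ gs
    where gs = reciprocalCoeffs f n

  -- 1/f, provided that f has constant coefficient 1.
  reciprocal : Series → Series
  reciprocal f n = head (reciprocalCoeffs f n)

  private
    lookup-reciprocalCoeffs : ∀ f n (i : Fin (suc n)) →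
      lookup (reciprocalCoeffs f n) i ≡ reciprocal f (n ℕ.∸ toℕ i)
    lookup-reciprocalCoeffs f zero    zero    = ≡.refl
    lookup-reciprocalCoeffs f (suc n) zero    = ≡.refl
    lookup-reciprocalCoeffs f (suc n) (suc i) = lookup-reciprocalCoeffs f n i

  *-reciprocal : ∀ f → f 0 R.≈ R.1# → f * reciprocal f ≈ 1#
  *-reciprocal f f₀≈1 = coeffwise λ where
    zero    → R.trans (R.+-identityʳ _) (R.trans (R.*-identityʳ _) f₀≈1)
    (suc n) → begin
      f 0 R.* reciprocal f (suc n) R.+ (tail f * reciprocal f) n
        ≈⟨ R.+-cong (R.trans (R.*-congʳ f₀≈1) (R.*-identityˡ _))
             (sum-cong-≋ {suc n} λ i → R.*-congˡ {f (suc (toℕ i))}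
               (R.reflexive (≡.sym (lookup-reciprocalCoeffs f n i)))) ⟩
      reciprocal f (suc n) R.+ (sum λ i → f (suc (toℕ i)) R.* lookup (reciprocalCoeffs f n) i)
        ≈⟨ R.-‿inverseˡ _ ⟩
      R.0# ∎

record IsIntegralDomain (R : CommutativeRing c ℓ) : Set (c ⊔ ℓ) where
  open CommutativeRing R
  field
    1≉0            : ¬ 1# ≈ 0#
    noZeroDivisors : ∀ x y → x * y ≈ 0# → x ≈ 0# ⊎ y ≈ 0#

  *-≉0 : ∀ {x y} → ¬ x ≈ 0# → ¬ y ≈ 0# → ¬ x * y ≈ 0#
  *-≉0 x≉0 y≉0 xy≈0 = [ x≉0 , y≉0 ]′ (noZeroDivisors _ _ xy≈0)

  open Exp semiring using (_^_)

  ^-≉0 : ∀ {x} → ¬ x ≈ 0# → ∀ n → ¬ x ^ n ≈ 0#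
  ^-≉0 x≉0 zero    = 1≉0
  ^-≉0 x≉0 (suc n) = *-≉0 x≉0 (^-≉0 x≉0 n)

  *-cancelˡ : ∀ z {x y} → ¬ z ≈ 0# → z * x ≈ z * y → x ≈ y
  *-cancelˡ z {x} {y} z≉0 eq = [ (λ z≈0 → ⊥-elim (z≉0 z≈0)) , x∙y⁻¹≈ε⇒x≈y x y ]′
    (noZeroDivisors z (x - y) (begin
      z * (x - y)         ≈⟨ distribˡ z x (- y) ⟩
      z * x + z * (- y)   ≈⟨ +-cong eq (sym (-‿distribʳ-* z y)) ⟩
      z * y - z * y       ≈⟨ -‿inverseʳ (z * y) ⟩
      0#                  ∎))
    where
    open RingProperties ring using (-‿distribʳ-*)
    open GroupProperties +-group using (x∙y⁻¹≈ε⇒x≈y)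
    open SetoidReasoning setoid

-- A polynomial is a list of coefficients, constant coefficient first;
-- trailing zeros are allowed and are ignored by _≈_.
module Polynomial (R : CommutativeRing c ℓ) where
  private
    module R = CommutativeRing R
    module S = PowerSeries R
    module SR = CommutativeRing S.commutativeRing
  open R using (Carrier)

  Poly : Set c
  Poly = List Carrier

  coeff : Poly → ℕ → Carrier
  coeff []      n       = R.0#
  coeff (a ∷ p) zero    = a
  coeff (a ∷ p) (suc n) = coeff p n

  record _≈_ (p q : Poly) : Set ℓ where
    constructor coeffwise
    field at : ∀ n → coeff p n R.≈ coeff q n
  open _≈_ public

  infix  4 _≈_
  infixl 6 _+_
  infixl 7 _*_
  infix  8 -_

  _+_ : Poly → Poly → Poly
  []      + q       = q
  (a ∷ p) + []      = a ∷ p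
  (a ∷ p) + (b ∷ q) = (a R.+ b) ∷ (p + q)

  -_ : Poly → Poly
  - p = map (λ a → R.- a) p

  scale : Carrier → Poly → Poly
  scale a = map (a R.*_)

  _*_ : Poly → Poly → Poly
  []      * q = []
  (a ∷ p) * q = scale a q + (R.0# ∷ p * q)

  C : Carrier → Poly
  C a = a ∷ []

  0# 1# t : Poly
  0# = []
  1# = C R.1#
  t  = R.0# ∷ R.1# ∷ []

  private
    coeff-+ : ∀ p q n → coeff (p + q) n R.≈ coeff p n R.+ coeff q n
    coeff-+ []      q       n       = R.sym (R.+-identityˡ _)
    coeff-+ (a ∷ p) []      n       = R.sym (R.+-identityʳ _)
    coeff-+ (a ∷ p) (b ∷ q) zero    = R.refl
    coeff-+ (a ∷ p) (b ∷ q) (suc n) = coeff-+ p q n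

    coeff-neg : ∀ p n → coeff (- p) n R.≈ R.- coeff p n
    coeff-neg []      n       = R.sym (GroupProperties.ε⁻¹≈ε R.+-group)
    coeff-neg (a ∷ p) zero    = R.refl
    coeff-neg (a ∷ p) (suc n) = coeff-neg p n

    coeff-scale : ∀ a p n → coeff (scale a p) n R.≈ a R.* coeff p n
    coeff-scale a []      n       = R.sym (R.zeroʳ a)
    coeff-scale a (b ∷ p) zero    = R.refl
    coeff-scale a (b ∷ p) (suc n) = coeff-scale a p n

    coeff-* : ∀ p q n → coeff (p * q) n R.≈ (coeff p S.* coeff q) n
    coeff-* []      q n       = R.sym (S.at (SR.zeroˡ (coeff q)) n)
    coeff-* (a ∷ p) q zero    =
      R.trans (coeff-+ (scale a q) _ 0) (R.+-congʳ (coeff-scale a q 0))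
    coeff-* (a ∷ p) q (suc n) =
      R.trans (coeff-+ (scale a q) _ (suc n))
              (R.+-cong (coeff-scale a q (suc n)) (coeff-* p q n))

    coeff-1 : ∀ n → coeff 1# n R.≈ S.1# n
    coeff-1 zero    = R.refl
    coeff-1 (suc n) = R.refl

  rawRing : RawRing c ℓ
  rawRing = record { _≈_ = _≈_ ; _+_ = _+_ ; _*_ = _*_ ; -_ = -_ ; 0# = 0# ; 1# = 1# }

  coeff-isRingMonomorphism : IsRingMonomorphism rawRing SR.rawRing coeff
  coeff-isRingMonomorphism = record
    { isRingHomomorphism = record
      { isSemiringHomomorphism = record
        { isNearSemiringHomomorphism = record
          { +-isMonoidHomomorphism = record
            { isMagmaHomomorphism = record
              { isRelHomomorphism = record { cong = λ p≈q → S.coeffwise (at p≈q) }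
              ; homo = λ p q → S.coeffwise (coeff-+ p q)
              }
            ; ε-homo = S.coeffwise λ _ → R.refl
            }
          ; *-homo = λ p q → S.coeffwise (coeff-* p q)
          }
        ; 1#-homo = S.coeffwise coeff-1
        }
      ; -‿homo = λ p → S.coeffwise (coeff-neg p)
      }
    ; injective = λ p≈q → coeffwise (S.at p≈q)
    }

  isCommutativeRing : IsCommutativeRing _≈_ _+_ _*_ -_ 0# 1#
  isCommutativeRing =
    RingMonomorphism.isCommutativeRing coeff-isRingMonomorphism SR.isCommutativeRing

  commutativeRing : CommutativeRing c ℓ
  commutativeRing = record { isCommutativeRing = isCommutativeRing }

  module _ (_≟_ : Decidable R._≈_) (isIntegralDomain : IsIntegralDomain R) where
    private
      module D = IsIntegralDomain isIntegralDomain
      module P = CommutativeRing commutativeRing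

      ∷-≈0 : ∀ {a p} → a R.≈ R.0# → p ≈ 0# → a ∷ p ≈ 0#
      ∷-≈0 a≈0 p≈0 = coeffwise λ { zero → a≈0 ; (suc n) → at p≈0 n }

      tail-* : ∀ a p q → a R.≈ R.0# → (a ∷ p) * q ≈ 0# → p * q ≈ 0#
      tail-* a p q a≈0 eq = coeffwise λ n → begin
        coeff (p * q) n
          ≈⟨ R.+-identityˡ _ ⟨
        R.0# R.+ coeff (p * q) n
          ≈⟨ R.+-congʳ (R.trans (coeff-scale a q (suc n))
               (R.trans (R.*-congʳ a≈0) (R.zeroˡ _))) ⟨
        coeff (scale a q) (suc n) R.+ coeff (p * q) n
          ≈⟨ coeff-+ (scale a q) (R.0# ∷ p * q) (suc n) ⟨
        coeff ((a ∷ p) * q) (suc n)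
          ≈⟨ at eq (suc n) ⟩
        R.0# ∎
        where open SetoidReasoning R.setoid

      cancel : ∀ a p → ¬ a R.≈ R.0# → ∀ q → (a ∷ p) * q ≈ 0# → q ≈ 0#
      cancel a p a≉0 []      eq = P.refl
      cancel a p a≉0 (b ∷ q) eq with b ≟ R.0#
      ... | yes b≈0 = ∷-≈0 b≈0 (cancel a p a≉0 q
        (P.trans (P.*-comm (a ∷ p) q)
          (tail-* b q (a ∷ p) b≈0 (P.trans (P.*-comm (b ∷ q) (a ∷ p)) eq))))
      ... | no b≉0  =
        ⊥-elim (D.*-≉0 a≉0 b≉0 (R.trans (R.sym (R.+-identityʳ _)) (at eq 0)))

      noZeroDivisors : ∀ p q → p * q ≈ 0# → p ≈ 0# ⊎ q ≈ 0#
      noZeroDivisors []      q eq = inj₁ P.refl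
      noZeroDivisors (a ∷ p) q eq with a ≟ R.0#
      ... | yes a≈0 = map₁ (∷-≈0 a≈0) (noZeroDivisors p q (tail-* a p q a≈0 eq))
      ... | no a≉0  = inj₂ (cancel a p a≉0 q eq)

    polynomial-isIntegralDomain : IsIntegralDomain commutativeRing
    polynomial-isIntegralDomain = record
      { 1≉0            = λ eq → D.1≉0 (at eq 0)
      ; noZeroDivisors = noZeroDivisors
      }

module FractionField (R : CommutativeRing c ℓ) (isIntegralDomain : IsIntegralDomain R) where
  private
    module R = CommutativeRing R
    module D = IsIntegralDomain isIntegralDomain
  open R using (Carrier)
  open RingProperties R.ring using (-‿distribˡ-*)
  open Solver R.commutativeSemiring
  open SetoidReasoning R.setoid

  infix 7 _over_[_]
  record Fraction : Set (c ⊔ ℓ) where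
    constructor _over_[_]
    field
      num   : Carrier
      den   : Carrier
      den≉0 : ¬ den R.≈ R.0#
  open Fraction public

  record _≈_ (x y : Fraction) : Set ℓ where
    constructor cross
    field cross-≈ : num x R.* den y R.≈ num y R.* den x
  open _≈_ public

  infix  4 _≈_
  infixl 6 _+_
  infixl 7 _*_
  infix  8 -_

  _+_ : Fraction → Fraction → Fraction
  (a over b [ b≉0 ]) + (c over d [ d≉0 ]) = (a R.* d R.+ c R.* b) over (b R.* d) [ D.*-≉0 b≉0 d≉0 ]

  _*_ : Fraction → Fraction → Fraction
  (a over b [ b≉0 ]) * (c over d [ d≉0 ]) = (a R.* c) over (b R.* d) [ D.*-≉0 b≉0 d≉0 ]

  -_ : Fraction → Fraction
  - (a over b [ b≉0 ]) = (R.- a) over b [ b≉0 ]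

  fromBase : Carrier → Fraction
  fromBase a = a over R.1# [ D.1≉0 ]

  0# 1# : Fraction
  0# = fromBase R.0#
  1# = fromBase R.1#

  private
    num≈0 : ∀ {x} → x ≈ 0# → num x R.≈ R.0#
    num≈0 (cross eq) = R.trans (R.sym (R.*-identityʳ _)) (R.trans eq (R.zeroˡ _))

    ≈0 : ∀ {x} → num x R.≈ R.0# → x ≈ 0#
    ≈0 eq = cross (R.trans (R.*-identityʳ _) (R.trans eq (R.sym (R.zeroˡ _))))

    trans : ∀ {x y z} → x ≈ y → y ≈ z → x ≈ z
    trans {a over b [ _ ]} {c over d [ d≉0 ]} {e over f [ _ ]} (cross p) (cross q) =
      cross (D.*-cancelˡ d d≉0 (begin
        d R.* (a R.* f) ≈⟨ solve 3 (λ d a f → d :* (a :* f) := (a :* d) :* f) R.refl d a f ⟩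
        (a R.* d) R.* f ≈⟨ R.*-congʳ p ⟩
        (c R.* b) R.* f ≈⟨ solve 3 (λ c b f → (c :* b) :* f := (c :* f) :* b) R.refl c b f ⟩
        (c R.* f) R.* b ≈⟨ R.*-congʳ q ⟩
        (e R.* d) R.* b ≈⟨ solve 3 (λ e d b → (e :* d) :* b := d :* (e :* b)) R.refl e d b ⟩
        d R.* (e R.* b) ∎))

    +-cong : ∀ {x x′ y y′} → x ≈ x′ → y ≈ y′ → x + y ≈ x′ + y′
    +-cong {a over b [ _ ]} {a′ over b′ [ _ ]} {c over d [ _ ]} {c′ over d′ [ _ ]} (cross p) (cross q) =
      cross (begin
        (a R.* d R.+ c R.* b) R.* (b′ R.* d′)
          ≈⟨ solve 6 (λ a b c d b′ d′ → (a :* d :+ c :* b) :* (b′ :* d′)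
               := (a :* b′) :* (d :* d′) :+ (c :* d′) :* (b :* b′)) R.refl a b c d b′ d′ ⟩
        (a R.* b′) R.* (d R.* d′) R.+ (c R.* d′) R.* (b R.* b′)
          ≈⟨ R.+-cong (R.*-congʳ p) (R.*-congʳ q) ⟩
        (a′ R.* b) R.* (d R.* d′) R.+ (c′ R.* d) R.* (b R.* b′)
          ≈⟨ solve 6 (λ a′ b c′ d b′ d′ → (a′ :* b) :* (d :* d′) :+ (c′ :* d) :* (b :* b′)
               := (a′ :* d′ :+ c′ :* b′) :* (b :* d)) R.refl a′ b c′ d b′ d′ ⟩
        (a′ R.* d′ R.+ c′ R.* b′) R.* (b R.* d) ∎)

    *-cong : ∀ {x x′ y y′} → x ≈ x′ → y ≈ y′ → x * y ≈ x′ * y′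
    *-cong {a over b [ _ ]} {a′ over b′ [ _ ]} {c over d [ _ ]} {c′ over d′ [ _ ]} (cross p) (cross q) =
      cross (begin
        (a R.* c) R.* (b′ R.* d′)
          ≈⟨ solve 4 (λ a c b′ d′ → (a :* c) :* (b′ :* d′) := (a :* b′) :* (c :* d′))
               R.refl a c b′ d′ ⟩
        (a R.* b′) R.* (c R.* d′)
          ≈⟨ R.*-cong p q ⟩
        (a′ R.* b) R.* (c′ R.* d)
          ≈⟨ solve 4 (λ a′ b c′ d → (a′ :* b) :* (c′ :* d) := (a′ :* c′) :* (b :* d))
               R.refl a′ b c′ d ⟩
        (a′ R.* c′) R.* (b R.* d) ∎)

    neg-cong : ∀ {x y} → x ≈ y → - x ≈ - y
    neg-cong (cross p) = cross
      (R.trans (R.sym (-‿distribˡ-* _ _)) (R.trans (R.-‿cong p) (-‿distribˡ-* _ _)))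

    inverseˡ : ∀ x → - x + x ≈ 0#
    inverseˡ (a over b [ _ ]) = cross (begin
      (R.- a R.* b R.+ a R.* b) R.* R.1#  ≈⟨ R.*-identityʳ _ ⟩
      R.- a R.* b R.+ a R.* b             ≈⟨ R.distribʳ _ _ _ ⟨
      (R.- a R.+ a) R.* b                 ≈⟨ R.*-congʳ (R.-‿inverseˡ a) ⟩
      R.0# R.* b                          ≈⟨ R.zeroˡ _ ⟩
      R.0#                                ≈⟨ R.zeroˡ _ ⟨
      R.0# R.* (b R.* b)                  ∎)

    +-comm : ∀ x y → x + y ≈ y + x
    +-comm (a over b [ _ ]) (c over d [ _ ]) = cross
      (solve 4 (λ a b c d → (a :* d :+ c :* b) :* (d :* b)
        := (c :* b :+ a :* d) :* (b :* d)) R.refl a b c d)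

    *-comm : ∀ x y → x * y ≈ y * x
    *-comm (a over b [ _ ]) (c over d [ _ ]) = cross
      (solve 4 (λ a b c d → (a :* c) :* (d :* b) := (c :* a) :* (b :* d)) R.refl a b c d)

    +-assoc : ∀ x y z → (x + y) + z ≈ x + (y + z)
    +-assoc (a over b [ _ ]) (c over d [ _ ]) (e over f [ _ ]) = cross
      (solve 6 (λ a b c d e f →
        ((a :* d :+ c :* b) :* f :+ e :* (b :* d)) :* (b :* (d :* f))
          := (a :* (d :* f) :+ (c :* f :+ e :* d) :* b) :* ((b :* d) :* f))
        R.refl a b c d e f)

    *-assoc : ∀ x y z → (x * y) * z ≈ x * (y * z)
    *-assoc (a over b [ _ ]) (c over d [ _ ]) (e over f [ _ ]) = cross
      (solve 6 (λ a b c d e f →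
        ((a :* c) :* e) :* (b :* (d :* f)) := (a :* (c :* e)) :* ((b :* d) :* f))
        R.refl a b c d e f)

    +-identityˡ : ∀ x → 0# + x ≈ x
    +-identityˡ (a over b [ _ ]) = cross (R.*-cong
      (R.trans (R.+-cong (R.zeroˡ b) (R.*-identityʳ a)) (R.+-identityˡ a))
      (R.sym (R.*-identityˡ b)))

    *-identityˡ : ∀ x → 1# * x ≈ x
    *-identityˡ (a over b [ _ ]) = cross
      (R.trans (R.*-congʳ (R.*-identityˡ a)) (R.*-congˡ (R.sym (R.*-identityˡ b))))

    distribˡ : ∀ x y z → x * (y + z) ≈ x * y + x * z
    distribˡ (a over b [ _ ]) (c over d [ _ ]) (e over f [ _ ]) = cross
      (solve 6 (λ a b c d e f →
        (a :* (c :* f :+ e :* d)) :* ((b :* d) :* (b :* f))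
          := ((a :* c) :* (b :* f) :+ (a :* e) :* (b :* d)) :* (b :* (d :* f)))
        R.refl a b c d e f)

  isCommutativeRing : IsCommutativeRing _≈_ _+_ _*_ -_ 0# 1#
  isCommutativeRing = record
    { isRing = record
      { +-isAbelianGroup = record
        { isGroup = record
          { isMonoid = record
            { isSemigroup = record
              { isMagma = record
                { isEquivalence = record
                  { refl  = cross R.refl
                  ; sym   = λ p → cross (R.sym (cross-≈ p))
                  ; trans = trans
                  }
                ; ∙-cong = +-cong
                }
              ; assoc = +-assoc
              }
            ; identity = +-identityˡ , λ x → trans (+-comm x 0#) (+-identityˡ x)
            }
          ; inverse = inverseˡ , λ x → trans (+-comm x (- x)) (inverseˡ x)
          ; ⁻¹-cong = neg-cong
          }
        ; comm = +-comm
        }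
      ; *-cong     = *-cong
      ; *-assoc    = *-assoc
      ; *-identity = *-identityˡ , λ x → trans (*-comm x 1#) (*-identityˡ x)
      ; distrib    = distribˡ , λ x y z →
          trans (*-comm (y + z) x)
            (trans (distribˡ x y z) (+-cong (*-comm x y) (*-comm x z)))
      }
    ; *-comm = *-comm
    }

  commutativeRing : CommutativeRing (c ⊔ ℓ) ℓ
  commutativeRing = record { isCommutativeRing = isCommutativeRing }

  fraction-isIntegralDomain : IsIntegralDomain commutativeRing
  fraction-isIntegralDomain = record
    { 1≉0            = λ eq → D.1≉0 (num≈0 eq)
    ; noZeroDivisors = λ where
        (a over _ [ _ ]) (c over _ [ _ ]) eq →
          [ inj₁ ∘ ≈0 , inj₂ ∘ ≈0 ]′ (D.noZeroDivisors a c (num≈0 eq))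
    }

  infix 7 _/_[_]
  _/_[_] : (x y : Fraction) → ¬ y ≈ 0# → Fraction
  x / y [ y≉0 ] = x * (den y over num y [ y≉0 ∘ ≈0 ])

  /-*-cancel : ∀ x y (y≉0 : ¬ y ≈ 0#) → (x / y [ y≉0 ]) * y ≈ x
  /-*-cancel (a over b [ _ ]) (c over d [ _ ]) _ = cross
    (solve 4 (λ a b c d → ((a :* d) :* c) :* b := a :* ((b :* c) :* d)) R.refl a b c d)

module RingNotation (R : CommutativeRing c ℓ) where
  open CommutativeRing R public using (Carrier; _≈_; _+_; _*_; _-_; -_; 0#; 1#)
  open Exp (CommutativeRing.semiring R) public using (_^_)
  open Sum (CommutativeRing.+-commutativeMonoid R) public using (sum⁺-syntax)
  open Mult (CommutativeRing.semiring R) using (_×_)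

  fromℤ : ℤ → Carrier
  fromℤ (+ n)    = n × 1#
  fromℤ -[1+ n ] = - (suc n × 1#)

  -- p ⟨ x ⟩ is p(x), the integer coefficients of p being mapped into R
  -- by the canonical homomorphism.
  infix 9 _⟨_⟩
  _⟨_⟩ : Polynomial.Poly ℤₚ.+-*-commutativeRing → Carrier → Carrier
  []      ⟨ x ⟩ = 0#
  (a ∷ p) ⟨ x ⟩ = fromℤ a + x * p ⟨ x ⟩

ℚ-isIntegralDomain : IsIntegralDomain ℚₚ.+-*-commutativeRing
ℚ-isIntegralDomain = record
  { 1≉0            = λ ()
  ; noZeroDivisors = noZeroDivisors
  }
  where
  noZeroDivisors : ∀ x y → x ℚ.* y ≡ 0ℚ → x ≡ 0ℚ ⊎ y ≡ 0ℚ
  noZeroDivisors x y xy≡0 with x ℚₚ.≟ 0ℚ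
  ... | yes x≡0 = inj₁ x≡0
  ... | no  x≢0 = inj₂ (begin
    y                          ≡⟨ ℚₚ.*-identityˡ y ⟨
    1ℚ ℚ.* y                   ≡⟨ ≡.cong (ℚ._* y) (ℚₚ.*-inverseˡ x) ⟨
    (ℚ.1/ x) ℚ.* x ℚ.* y       ≡⟨ ℚₚ.*-assoc (ℚ.1/ x) x y ⟩
    (ℚ.1/ x) ℚ.* (x ℚ.* y)     ≡⟨ ≡.cong ((ℚ.1/ x) ℚ.*_) xy≡0 ⟩
    (ℚ.1/ x) ℚ.* 0ℚ            ≡⟨ ℚₚ.*-zeroʳ (ℚ.1/ x) ⟩
    0ℚ                         ∎)
    where
    open ≡.≡-Reasoning
    instance _ = ℚ.≢-nonZero x≢0

module ℤ[t] where
  open Polynomial ℤₚ.+-*-commutativeRing public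
    using (Poly; coeff; C; t; coeffwise; at; commutativeRing)
  open RingNotation commutativeRing public

module ℚ[t] where
  open Polynomial ℚₚ.+-*-commutativeRing public
    using (Poly; coeff; C; t; coeffwise; at; commutativeRing; polynomial-isIntegralDomain)
  open RingNotation commutativeRing public

  isIntegralDomain : IsIntegralDomain commutativeRing
  isIntegralDomain = polynomial-isIntegralDomain ℚₚ._≟_ ℚ-isIntegralDomain

module ℚ⟨t⟩ where
  open FractionField ℚ[t].commutativeRing ℚ[t].isIntegralDomain public
    using (Fraction; _over_[_]; num; den; den≉0; cross; cross-≈; fromBase;
           _/_[_]; /-*-cancel; commutativeRing; fraction-isIntegralDomain)
  open RingNotation commutativeRing public

  t : Fraction
  t = fromBase ℚ[t].t

  t^n≉0 : ∀ n → ¬ t ^ n ≈ 0#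
  t^n≉0 = IsIntegralDomain.^-≉0 fraction-isIntegralDomain λ eq →
    IsIntegralDomain.1≉0 ℚ-isIntegralDomain (ℚ[t].at (cross-≈ eq) 1)

  t^4-1≉0 : ¬ t ^ 4 - 1# ≈ 0#
  t^4-1≉0 eq = -1≢0 (ℚ[t].at (cross-≈ eq) 0)
    where
    -1≢0 : ¬ ℚ.- 1ℚ ≡ 0ℚ
    -1≢0 ()

module _ where
  open ℤ[t]

  private
    -- For even n ≥ 2, n = 2 ⌊n/2⌋; for odd n, n = 2 ⌊n/2⌋ + 1 and
    -- ⌈n/2⌉ = ⌊n/2⌋ + 1.
    stern : ∀ n → Acc _<_ n → Poly
    stern 0 _ = 0#
    stern 1 _ = 1#
    stern n@(suc (suc k)) (acc rec) =
      if does (2 ∣? n)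
      then t * stern ⌊ n /2⌋ (rec (ℕₚ.⌊n/2⌋<n (suc k)))
      else stern ⌊ n /2⌋ (rec (ℕₚ.⌊n/2⌋<n (suc k))) + stern ⌈ n /2⌉ (rec (ℕₚ.⌈n/2⌉<n k))

    stern-irrelevant : ∀ n (r s : Acc _<_ n) → stern n r ≡ stern n s
    stern-irrelevant 0 _ _ = ≡.refl
    stern-irrelevant 1 _ _ = ≡.refl
    stern-irrelevant n@(suc (suc k)) (acc r) (acc s) with does (2 ∣? n)
    ... | true  = ≡.cong (t *_) (stern-irrelevant ⌊ n /2⌋ _ _)
    ... | false = ≡.cong₂ _+_ (stern-irrelevant ⌊ n /2⌋ _ _) (stern-irrelevant ⌈ n /2⌉ _ _)

  B : ℕ → Poly
  B n = stern n (<-wellFounded n)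

  B-0 : B 0 ≡ 0#
  B-0 = ≡.refl

  B-1 : B 1 ≡ 1#
  B-1 = ≡.refl

  private
    stern-even : ∀ n (r : Acc _<_ n) → 2 ℕ.≤ n → 2 ∣ n → stern n r ≡ t * B ⌊ n /2⌋
    stern-even n@(suc (suc k)) (acc r) (s≤s (s≤s z≤n)) 2∣n
      rewrite dec-true (2 ∣? n) 2∣n = ≡.cong (t *_) (stern-irrelevant ⌊ n /2⌋ _ _)

    stern-odd : ∀ n (r : Acc _<_ n) → 2 ℕ.≤ n → ¬ 2 ∣ n →
                stern n r ≡ B ⌊ n /2⌋ + B ⌈ n /2⌉
    stern-odd n@(suc (suc k)) (acc r) (s≤s (s≤s z≤n)) 2∤n
      rewrite dec-false (2 ∣? n) 2∤n =
        ≡.cong₂ _+_ (stern-irrelevant ⌊ n /2⌋ _ _) (stern-irrelevant ⌈ n /2⌉ _ _)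

    double : ∀ n → 2 ℕ.* n ≡ n ℕ.+ n
    double n = ≡.cong (n ℕ.+_) (ℕₚ.+-identityʳ n)

    ⌊2n/2⌋≡n : ∀ n → ⌊ 2 ℕ.* n /2⌋ ≡ n
    ⌊2n/2⌋≡n n = ≡.trans (≡.cong ⌊_/2⌋ (double n)) (≡.sym (ℕₚ.n≡⌊n+n/2⌋ n))

    ⌈2n/2⌉≡n : ∀ n → ⌈ 2 ℕ.* n /2⌉ ≡ n
    ⌈2n/2⌉≡n n = ≡.trans (≡.cong ⌈_/2⌉ (double n)) (≡.sym (ℕₚ.n≡⌈n+n/2⌉ n))

    2≤2n : ∀ {n} → 1 ℕ.≤ n → 2 ℕ.≤ 2 ℕ.* n
    2≤2n = ℕₚ.*-monoʳ-≤ 2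

    2∤2n+1 : ∀ n → ¬ 2 ∣ 2 ℕ.* n ℕ.+ 1
    2∤2n+1 n 2∣2n+1 = ℕₚ.1+n≰n (∣⇒≤ (∣m+n∣m⇒∣n 2∣2n+1 (m∣m*n n)))

  B-even : ∀ n → 1 ℕ.≤ n → B (2 ℕ.* n) ≡ t * B n
  B-even n 1≤n = ≡.trans (stern-even (2 ℕ.* n) _ (2≤2n 1≤n) (m∣m*n n))
                         (≡.cong (λ k → t * B k) (⌊2n/2⌋≡n n))

  B-odd : ∀ n → 1 ℕ.≤ n → B (2 ℕ.* n ℕ.+ 1) ≡ B n + B (n ℕ.+ 1)
  B-odd n 1≤n = ≡.trans
    (stern-odd (2 ℕ.* n ℕ.+ 1) _ (ℕₚ.m≤n⇒m≤n+o 1 (2≤2n 1≤n)) (2∤2n+1 n))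
    (≡.cong₂ (λ j k → B j + B k)
      (≡.trans (≡.cong ⌊_/2⌋ (ℕₚ.+-comm (2 ℕ.* n) 1)) (⌈2n/2⌉≡n n))
      (≡.trans (≡.cong ⌈_/2⌉ (ℕₚ.+-comm (2 ℕ.* n) 1))
        (≡.trans (≡.cong suc (⌊2n/2⌋≡n n)) (ℕₚ.+-comm 1 n))))

module ℤ[t]⟦x⟧ = PowerSeries ℤ[t].commutativeRing

module _ where
  open ℤ[t]

  -- 1 - 2 t x + x², as a polynomial in x over ℤ[t]
  chebyshevDenominator : ℤ[t]⟦x⟧.Series
  chebyshevDenominator =
    Polynomial.coeff ℤ[t].commutativeRing (1# ∷ - (C (+ 2) * t) ∷ 1# ∷ [])

  U : ℕ → Poly
  U = ℤ[t]⟦x⟧.reciprocal chebyshevDenominator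

U-generatingFunction :
  chebyshevDenominator ℤ[t]⟦x⟧.* U ℤ[t]⟦x⟧.≈ ℤ[t]⟦x⟧.1#
U-generatingFunction = ℤ[t]⟦x⟧.*-reciprocal chebyshevDenominator
  (CommutativeRing.refl ℤ[t].commutativeRing)

-- With b(x) = ∑ Bₙ(s) xⁿ the Stern recurrence becomes the functional equation
-- x b(x) = (1 + s x + x²) b(x²).  Dividing by the quadratic factor gives (i), since
-- ∑ Uₙ(-t/2) xⁿ = 1 / (1 + t x + x²), and (iii), since for s = -t² - t⁻² Binet's
-- formula expands x / (1 + s x + x²).  For (ii), multiply the equations for s = t and
-- s = -t: as (1 + t x + x²)(1 - t x + x²) = 1 + (2 - t²) x² + x⁴, the product series is
-- h(x²), where h solves the functional equation for s = 2 - t²; such a solution is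
-- determined by its coefficient of x.
module Submission where

open import Defs
open import Algebra.Bundles using (CommutativeRing)
import Algebra.Morphism.Construct.Identity as Identity
open import Algebra.Morphism.Structures using (IsRingHomomorphism; IsRingMonomorphism)
import Algebra.Properties.AbelianGroup as AbelianGroupProperties
import Algebra.Properties.CommutativeSemigroup as CommutativeSemigroupProperties
import Algebra.Properties.Ring as RingProperties
import Algebra.Properties.Semiring.Exp as Exp
import Algebra.Properties.Semiring.Mult as Mult
import Algebra.Properties.Semiring.Sum as Sum
import Algebra.Solver.Ring as RingSolver
open import Algebra.Solver.Ring.AlmostCommutativeRing
  using (fromCommutativeRing; Induced-equivalence; _-Raw-AlmostCommutative⟶_)
open import Data.Bool.Base using (if_then_else_)
open import Data.Fin.Base using (Fin; zero; suc; toℕ)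
open import Data.Integer.Base as ℤ using (+_; -[1+_]; _⊖_)
import Data.Integer.Properties as ℤₚ
open import Data.List.Base using ([]; _∷_)
open import Data.Maybe.Base using (map)
open import Data.Nat.Base as ℕ using (ℕ; zero; suc; _∸_; _<_; z≤n; s≤s)
open import Data.Nat.Divisibility using (_∣?_)
open import Data.Nat.DivMod using (m/n≡1+[m∸n]/n)
open import Data.Nat.Induction using (<-rec)
import Data.Nat.Properties as ℕₚ
open import Data.Product.Base using (∃; _×_; _,_)
open import Data.Rational.Base using (½)
open import Data.Sum.Base using (_⊎_; inj₁; inj₂)
open import Function.Base using (_∘_)
open import Level using (Level)
open import Relation.Binary.Definitions using (WeaklyDecidable)
open import Relation.Binary.PropositionalEquality as ≡ using (_≡_)
import Relation.Binary.Reasoning.Setoid as SetoidReasoning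
open import Relation.Nullary using (¬_; does)
open import Relation.Nullary.Decidable using (dec⇒maybe)

private variable
  c ℓ c′ ℓ′ : Level

-- The canonical map from ℤ to a commutative ring, and evaluation of integer polynomials.

module IntegerCoefficients (R : CommutativeRing c ℓ) where
  open CommutativeRing R
  open RingNotation R using (fromℤ; _⟨_⟩)
  open Mult semiring using (×-homo-+; ×1-homo-*) renaming (_×_ to _·_)
  open AbelianGroupProperties +-abelianGroup using (⁻¹-∙-comm; ε⁻¹≈ε; ⁻¹-involutive; xyx⁻¹≈y)
  open RingProperties ring using (-‿distribˡ-*; -‿distribʳ-*)
  open SetoidReasoning setoid

  private
    fromℤ-⊖ : ∀ m n → fromℤ (m ⊖ n) ≈ m · 1# - n · 1#
    fromℤ-⊖ m       zero    = sym (trans (+-congˡ ε⁻¹≈ε) (+-identityʳ _))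
    fromℤ-⊖ zero    (suc n) = sym (+-identityˡ _)
    fromℤ-⊖ (suc m) (suc n) = begin
      fromℤ (suc m ⊖ suc n)           ≡⟨ ≡.cong fromℤ (ℤₚ.[1+m]⊖[1+n]≡m⊖n m n) ⟩
      fromℤ (m ⊖ n)                   ≈⟨ fromℤ-⊖ m n ⟩
      m · 1# - n · 1#                 ≈⟨ +-congʳ (xyx⁻¹≈y 1# (m · 1#)) ⟨
      1# + m · 1# - 1# - n · 1#       ≈⟨ +-assoc _ _ _ ⟩
      1# + m · 1# + (- 1# - n · 1#)   ≈⟨ +-congˡ (⁻¹-∙-comm 1# (n · 1#)) ⟩
      suc m · 1# - suc n · 1#         ∎

    fromℤ-neg : ∀ a → fromℤ (ℤ.- a) ≈ - fromℤ a
    fromℤ-neg (+ zero)   = sym ε⁻¹≈ε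
    fromℤ-neg (+ suc n)  = refl
    fromℤ-neg -[1+ n ]   = sym (⁻¹-involutive _)

    fromℤ-+ : ∀ a b → fromℤ (a ℤ.+ b) ≈ fromℤ a + fromℤ b
    fromℤ-+ (+ m)    (+ n)    = ×-homo-+ 1# m n
    fromℤ-+ (+ m)    -[1+ n ] = fromℤ-⊖ m (suc n)
    fromℤ-+ -[1+ m ] (+ n)    = trans (fromℤ-⊖ n (suc m)) (+-comm _ _)
    fromℤ-+ -[1+ m ] -[1+ n ] = begin
      - (suc (suc (m ℕ.+ n)) · 1#)        ≡⟨ ≡.cong (λ k → - (k · 1#)) (ℕₚ.+-suc (suc m) n) ⟨
      - ((suc m ℕ.+ suc n) · 1#)          ≈⟨ -‿cong (×-homo-+ 1# (suc m) (suc n)) ⟩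
      - (suc m · 1# + suc n · 1#)         ≈⟨ ⁻¹-∙-comm _ _ ⟨
      - (suc m · 1#) - suc n · 1#         ∎

    fromℤ-pos-pos : ∀ m n → fromℤ (+ m ℤ.* + n) ≈ m · 1# * (n · 1#)
    fromℤ-pos-pos m n = trans (reflexive (≡.cong fromℤ (≡.sym (ℤₚ.pos-* m n)))) (×1-homo-* m n)

    fromℤ-pos-* : ∀ m b → fromℤ (+ m ℤ.* b) ≈ m · 1# * fromℤ b
    fromℤ-pos-* m (+ n)    = fromℤ-pos-pos m n
    fromℤ-pos-* m -[1+ n ] = begin
      fromℤ (+ m ℤ.* ℤ.- (+ suc n))     ≡⟨ ≡.cong fromℤ (ℤₚ.neg-distribʳ-* (+ m) (+ suc n)) ⟨
      fromℤ (ℤ.- (+ m ℤ.* + suc n))     ≈⟨ fromℤ-neg (+ m ℤ.* + suc n) ⟩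
      - fromℤ (+ m ℤ.* + suc n)         ≈⟨ -‿cong (fromℤ-pos-pos m (suc n)) ⟩
      - (m · 1# * (suc n · 1#))         ≈⟨ -‿distribʳ-* _ _ ⟩
      m · 1# * fromℤ -[1+ n ]           ∎

    fromℤ-* : ∀ a b → fromℤ (a ℤ.* b) ≈ fromℤ a * fromℤ b
    fromℤ-* (+ m)    b = fromℤ-pos-* m b
    fromℤ-* -[1+ m ] b = begin
      fromℤ (ℤ.- (+ suc m) ℤ.* b)       ≡⟨ ≡.cong fromℤ (ℤₚ.neg-distribˡ-* (+ suc m) b) ⟨
      fromℤ (ℤ.- (+ suc m ℤ.* b))       ≈⟨ fromℤ-neg (+ suc m ℤ.* b) ⟩
      - fromℤ (+ suc m ℤ.* b)           ≈⟨ -‿cong (fromℤ-pos-* (suc m) b) ⟩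
      - (suc m · 1# * fromℤ b)          ≈⟨ -‿distribˡ-* _ _ ⟩
      fromℤ -[1+ m ] * fromℤ b          ∎

    -- Coefficient map for the ring solver: with integer coefficients, whose equality is decidable,
    -- it can also cancel terms of opposite sign.
    fromℤ-morphism : ℤ.+-*-rawRing -Raw-AlmostCommutative⟶ fromCommutativeRing R
    fromℤ-morphism = record
      { ⟦_⟧    = fromℤ
      ; +-homo = fromℤ-+
      ; *-homo = fromℤ-*
      ; -‿homo = fromℤ-neg
      ; 0-homo = refl
      ; 1-homo = +-identityʳ 1#
      }

    _coeff≟_ : WeaklyDecidable (Induced-equivalence fromℤ-morphism)
    a coeff≟ b = map (λ a≡b → reflexive (≡.cong fromℤ a≡b)) (dec⇒maybe (a ℤₚ.≟ b))

  open RingSolver ℤ.+-*-rawRing (fromCommutativeRing R) fromℤ-morphism _coeff≟_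
    public using (solve; _:+_; _:*_; _:-_; :-_; _:=_)

  private
    module P = Polynomial ℤₚ.+-*-commutativeRing

  module _ (x : Carrier) where
    private
      ∷-cong : ∀ {a p b q} → a ≡ b → p ⟨ x ⟩ ≈ q ⟨ x ⟩ → (a ∷ p) ⟨ x ⟩ ≈ (b ∷ q) ⟨ x ⟩
      ∷-cong a≡b p≈q = +-cong (reflexive (≡.cong fromℤ a≡b)) (*-congˡ p≈q)

      0∷[] : (+ 0 ∷ []) ⟨ x ⟩ ≈ 0#
      0∷[] = trans (+-identityˡ _) (zeroʳ x)

      -- Equal polynomials may be lists of different lengths. Where one list has ended, the
      -- remaining coefficients of the other are zero, and Horner's scheme contributes nothing for
      -- them by `0∷[]`.
      ⟨⟩-cong : ∀ {p q} → p P.≈ q → p ⟨ x ⟩ ≈ q ⟨ x ⟩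
      ⟨⟩-cong {[]}    {[]}    p≈q = refl
      ⟨⟩-cong {[]}    {b ∷ q} p≈q = trans (sym 0∷[])
        (∷-cong {p = []} {q = q} (P.at p≈q 0) (⟨⟩-cong {[]} {q} (P.coeffwise λ n → P.at p≈q (suc n))))
      ⟨⟩-cong {a ∷ p} {[]}    p≈q = trans
        (∷-cong {p = p} {q = []} (P.at p≈q 0) (⟨⟩-cong {p} {[]} (P.coeffwise λ n → P.at p≈q (suc n)))) 0∷[]
      ⟨⟩-cong {a ∷ p} {b ∷ q} p≈q =
        ∷-cong {p = p} {q = q} (P.at p≈q 0) (⟨⟩-cong {p} {q} (P.coeffwise λ n → P.at p≈q (suc n)))

      ⟨⟩-+ : ∀ p q → (p P.+ q) ⟨ x ⟩ ≈ p ⟨ x ⟩ + q ⟨ x ⟩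
      ⟨⟩-+ []      q       = sym (+-identityˡ _)
      ⟨⟩-+ (a ∷ p) []      = sym (+-identityʳ _)
      ⟨⟩-+ (a ∷ p) (b ∷ q) = trans (+-cong (fromℤ-+ a b) (*-congˡ (⟨⟩-+ p q)))
        (solve 5 (λ a b x p q → a :+ b :+ x :* (p :+ q) := a :+ x :* p :+ (b :+ x :* q))
          refl (fromℤ a) (fromℤ b) x (p ⟨ x ⟩) (q ⟨ x ⟩))

      ⟨⟩-neg : ∀ p → (P.- p) ⟨ x ⟩ ≈ - p ⟨ x ⟩
      ⟨⟩-neg []      = sym ε⁻¹≈ε
      ⟨⟩-neg (a ∷ p) = trans (+-cong (fromℤ-neg a) (*-congˡ (⟨⟩-neg p)))
        (solve 3 (λ a x p → :- a :+ x :* (:- p) := :- (a :+ x :* p))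
          refl (fromℤ a) x (p ⟨ x ⟩))

      ⟨⟩-scale : ∀ a p → P.scale a p ⟨ x ⟩ ≈ fromℤ a * p ⟨ x ⟩
      ⟨⟩-scale a []      = sym (zeroʳ _)
      ⟨⟩-scale a (b ∷ p) = trans (+-cong (fromℤ-* a b) (*-congˡ (⟨⟩-scale a p)))
        (solve 4 (λ a b x p → a :* b :+ x :* (a :* p) := a :* (b :+ x :* p))
          refl (fromℤ a) (fromℤ b) x (p ⟨ x ⟩))

      ⟨⟩-* : ∀ p q → (p P.* q) ⟨ x ⟩ ≈ p ⟨ x ⟩ * q ⟨ x ⟩
      ⟨⟩-* []      q = sym (zeroˡ _)
      ⟨⟩-* (a ∷ p) q = begin
        (P.scale a q P.+ (+ 0 ∷ p P.* q)) ⟨ x ⟩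
          ≈⟨ ⟨⟩-+ (P.scale a q) (+ 0 ∷ p P.* q) ⟩
        P.scale a q ⟨ x ⟩ + (0# + x * (p P.* q) ⟨ x ⟩)
          ≈⟨ +-cong (⟨⟩-scale a q) (trans (+-identityˡ _) (*-congˡ (⟨⟩-* p q))) ⟩
        fromℤ a * q ⟨ x ⟩ + x * (p ⟨ x ⟩ * q ⟨ x ⟩)
          ≈⟨ solve 4 (λ a x p q → a :* q :+ x :* (p :* q) := (a :+ x :* p) :* q)
               refl (fromℤ a) x (p ⟨ x ⟩) (q ⟨ x ⟩) ⟩
        (a ∷ p) ⟨ x ⟩ * q ⟨ x ⟩ ∎

    ⟨⟩-isRingHomomorphism : IsRingHomomorphism P.rawRing rawRing (_⟨ x ⟩)
    ⟨⟩-isRingHomomorphism = record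
      { isSemiringHomomorphism = record
        { isNearSemiringHomomorphism = record
          { +-isMonoidHomomorphism = record
            { isMagmaHomomorphism = record
              { isRelHomomorphism = record { cong = λ {p} {q} → ⟨⟩-cong {p} {q} }
              ; homo = ⟨⟩-+
              }
            ; ε-homo = refl
            }
          ; *-homo = ⟨⟩-*
          }
        ; 1#-homo = trans (+-congˡ (zeroʳ x)) (trans (+-identityʳ _) (+-identityʳ 1#))
        }
      ; -‿homo = ⟨⟩-neg
      }

-- Parity, and ring homomorphisms applied to power series coefficientwise.

even⊎odd : ∀ n → ∃ λ k → n ≡ 2 ℕ.* k ⊎ n ≡ suc (2 ℕ.* k)
even⊎odd zero    = 0 , inj₁ ≡.refl
even⊎odd (suc n) with even⊎odd n
... | k , inj₁ ≡.refl = k , inj₂ ≡.refl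
... | k , inj₂ ≡.refl = suc k , inj₁ (≡.sym (ℕₚ.*-suc 2 k))

module _ {R : CommutativeRing c ℓ} {R′ : CommutativeRing c′ ℓ′} where
  private
    module R  = CommutativeRing R
    module R′ = CommutativeRing R′
    module S  = PowerSeries R
    module S′ = PowerSeries R′
  open Sum R.semiring using (sum)
  open Sum R′.semiring using () renaming (sum to sum′; sum-cong-≋ to sum′-cong)

  module _ {φ : R.Carrier → R′.Carrier} (φ-homo : IsRingHomomorphism R.rawRing R′.rawRing φ) where
    open IsRingHomomorphism φ-homo

    sum-homo : ∀ {n} (f : Fin n → R.Carrier) → φ (sum f) R′.≈ sum′ (φ ∘ f)
    sum-homo {zero}  f = 0#-homo
    sum-homo {suc n} f = R′.trans (+-homo _ _) (R′.+-congˡ (sum-homo (f ∘ suc)))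

    -- Carries the generating function of the Chebyshev polynomials from integer polynomials to
    -- their values at a point.
    series-*-homo : ∀ f g → φ ∘ (f S.* g) S′.≈ (φ ∘ f) S′.* (φ ∘ g)
    series-*-homo f g = S′.coeffwise λ n → R′.trans
      (sum-homo {suc n} λ i → f (toℕ i) R.* g (n ℕ.∸ toℕ i))
      (sum′-cong {suc n} λ i → *-homo (f (toℕ i)) (g (n ℕ.∸ toℕ i)))

-- Power series: the factors x and 1 + s x + x², and the substitution of x² for x.

module SternSeries (R : CommutativeRing c ℓ) where
  open CommutativeRing R
  open RingNotation R using (_^_)
  open IntegerCoefficients R using (solve; _:+_; _:*_; _:-_; :-_; _:=_)
  private
    module P  = Polynomial R
    module S  = PowerSeries R
    module SR = CommutativeRing S.commutativeRing
    module ≈-Reasoning = SetoidReasoning setoid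
    module ≈ˢ-Reasoning = SetoidReasoning SR.setoid
    module ˢ = IntegerCoefficients S.commutativeRing
    open CommutativeSemigroupProperties SR.*-commutativeSemigroup using (x∙yz≈y∙xz; xy∙z≈y∙xz; x∙yz≈yx∙z)
  open S using (Series; at; coeffwise)

  -- Both `X` and `D s` are coefficient lists, so that a convolution with them unfolds term by term
  -- and leaves a convolution with a shorter list.
  X : Series
  X = P.coeff P.t

  D : Carrier → Series
  D s = P.coeff (1# ∷ s ∷ 1# ∷ [])

  private
    coeff-1-* : ∀ f n → (P.coeff (1# ∷ []) S.* f) n ≈ f n
    coeff-1-* f = at (SR.trans (SR.*-congʳ 1#-homo) (SR.*-identityˡ f))
      where open IsRingMonomorphism P.coeff-isRingMonomorphism using (1#-homo)

  X-* : ∀ f n → (X S.* f) (suc n) ≈ f n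
  X-* f n = trans (+-cong (zeroˡ _) (coeff-1-* f n)) (+-identityˡ _)

  X-*-0 : ∀ f → (X S.* f) 0 ≈ 0#
  X-*-0 f = trans (+-identityʳ _) (zeroˡ _)

  X-cancelˡ : ∀ {f g} → X S.* f S.≈ X S.* g → f S.≈ g
  X-cancelˡ {f} {g} eq = coeffwise λ n →
    trans (sym (X-* f n)) (trans (at eq (suc n)) (X-* g n))

  D-* : ∀ s f n → (D s S.* f) (suc (suc n)) ≈ f (suc (suc n)) + (s * f (suc n) + f n)
  D-* s f n = +-cong (*-identityˡ _) (+-congˡ (coeff-1-* f n))

  D-*-0 : ∀ s f → (D s S.* f) 0 ≈ f 0
  D-*-0 s f = trans (+-identityʳ _) (*-identityˡ _)

  D-*-1 : ∀ s f → (D s S.* f) 1 ≈ f 1 + s * f 0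
  D-*-1 s f = +-cong (*-identityˡ _) (+-identityʳ _)

  -- f(x) ↦ f(x²)
  expand : Series → Series
  expand f zero          = f 0
  expand f (suc zero)    = 0#
  expand f (suc (suc n)) = expand (f ∘ suc) n

  expand-cong : ∀ {f g} → f S.≈ g → expand f S.≈ expand g
  expand-cong f≈g = coeffwise (go f≈g)
    where
    go : ∀ {f g} → f S.≈ g → ∀ n → expand f n ≈ expand g n
    go f≈g zero          = at f≈g 0
    go f≈g (suc zero)    = refl
    go f≈g (suc (suc n)) = go (coeffwise (at f≈g ∘ suc)) n

  expand-even : ∀ f n → expand f (2 ℕ.* n) ≡ f n
  expand-even f zero    = ≡.refl
  expand-even f (suc n) = ≡.trans (≡.cong (expand f) (ℕₚ.*-suc 2 n)) (expand-even (f ∘ suc) n)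

  expand-odd : ∀ f n → expand f (suc (2 ℕ.* n)) ≡ 0#
  expand-odd f zero    = ≡.refl
  expand-odd f (suc n) =
    ≡.trans (≡.cong (expand f ∘ suc) (ℕₚ.*-suc 2 n)) (expand-odd (f ∘ suc) n)

  private
    -- This combination is the one that arises when a coefficient of a product is unfolded: at
    -- `suc k`, `f S.* g` has the term `f 0 * g (suc k)` plus coefficient `k` of the product with
    -- `f` shifted.
    expand-affine : ∀ a f g n →
      expand (λ k → a * f k + g k) n ≈ a * expand f n + expand g n
    expand-affine a f g zero          = refl
    expand-affine a f g (suc zero)    = sym (trans (+-identityʳ _) (zeroʳ a))
    expand-affine a f g (suc (suc n)) = expand-affine a (f ∘ suc) (g ∘ suc) n

  expand-* : ∀ f g → expand (f S.* g) S.≈ expand f S.* expand g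
  expand-* f g = coeffwise (go f g)
    where
    go : ∀ f g n → expand (f S.* g) n ≈ (expand f S.* expand g) n
    go f g zero          = refl
    go f g (suc zero)    =
      sym (trans (+-cong (zeroʳ _) (trans (+-identityʳ _) (zeroˡ _))) (+-identityʳ _))
    go f g (suc (suc n)) = begin
      expand (λ k → f 0 * g (suc k) + ((f ∘ suc) S.* g) k) n
        ≈⟨ expand-affine (f 0) (g ∘ suc) ((f ∘ suc) S.* g) n ⟩
      f 0 * expand (g ∘ suc) n + expand ((f ∘ suc) S.* g) n
        -- The convolution on the right also has a term with the factor `expand f 1`, which is `0#`;
        -- that zero term is inserted here.
        ≈⟨ +-congˡ (trans (sym (+-identityˡ _)) (+-cong (sym (zeroˡ _)) (go (f ∘ suc) g n))) ⟩
      (expand f S.* expand g) (suc (suc n)) ∎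
      where open ≈-Reasoning

  private
    expand-1 : ∀ n → expand (P.coeff P.1#) (suc n) ≈ 0#
    expand-1 zero    = refl
    expand-1 (suc n) = expand-[] n
      where
      expand-[] : ∀ n → expand (P.coeff []) n ≈ 0#
      expand-[] zero          = refl
      expand-[] (suc zero)    = refl
      expand-[] (suc (suc n)) = expand-[] n

  -- A difference of squares: (1 + x²)² - s² x² = 1 + (2 - s²) x² + x⁴. Coefficients 0 to 4 are
  -- compared one by one; all later ones vanish.
  expand-D : ∀ s → expand (D (1# + 1# - s ^ 2)) S.≈ D s S.* D (- s)
  expand-D s = coeffwise λ n → sym (go n)
    where
    go : ∀ n → (D s S.* D (- s)) n ≈ expand (D (1# + 1# - s ^ 2)) n
    go 0 = D-*-0 s (D (- s))
    go 1 = trans (D-*-1 s (D (- s))) (trans (+-congˡ (*-identityʳ s)) (-‿inverseˡ s))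
    go 2 = trans (D-* s (D (- s)) 0) (trans
      (solve 2 (λ o s → o :+ (s :* :- s :+ o) := o :+ o :- s :* s) refl 1# s)
      (+-congˡ (-‿cong (*-congˡ (sym (*-identityʳ s))))))
    go 3 = trans (D-* s (D (- s)) 1)
      (trans (+-identityˡ _) (trans (+-congʳ (*-identityʳ s)) (-‿inverseʳ s)))
    go 4 = trans (D-* s (D (- s)) 2)
      (trans (+-identityˡ _) (trans (+-congʳ (zeroʳ s)) (+-identityˡ 1#)))
    go (suc (suc (suc (suc (suc n))))) = trans (D-* s (D (- s)) (suc (suc (suc n))))
      (trans (+-identityˡ _) (trans (+-congʳ (zeroʳ s)) (trans (+-identityˡ 0#) (sym (expand-1 n)))))

  -- Turns the case distinction of the theorem into a coefficient of f(x²), by induction in steps of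
  -- two.
  even-part≡expand : ∀ f n → (if does (2 ∣? n) then f (n ℕ./ 2) else 0#) ≡ expand f n
  even-part≡expand f zero          = ≡.refl
  even-part≡expand f (suc zero)    = ≡.refl
  even-part≡expand f (suc (suc n)) = ≡.trans
    -- The divisibility test for `suc (suc n)` reduces to the one for `n` by computation; the
    -- quotient does not and has to be rewritten.
    (≡.cong (λ k → if does (2 ∣? n) then f k else 0#) (m/n≡1+[m∸n]/n {suc (suc n)} {2} (s≤s (s≤s z≤n))))
    (even-part≡expand (f ∘ suc) n)

  odd-part≡expand-suc : ∀ f n →
    (if does (2 ∣? n) then 0# else f ((n ℕ.+ 1) ℕ./ 2)) ≡ expand f (suc n)
  odd-part≡expand-suc f zero          = ≡.refl
  odd-part≡expand-suc f (suc zero)    = ≡.refl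
  odd-part≡expand-suc f (suc (suc n)) = ≡.trans
    (≡.cong (λ k → if does (2 ∣? n) then 0# else f k)
      (m/n≡1+[m∸n]/n {suc (suc (n ℕ.+ 1))} {2} (s≤s (s≤s z≤n))))
    (odd-part≡expand-suc (f ∘ suc) n)

  -- The functional equation x b(x) = (1 + s x + x²) b(x²).

  IsStern : Carrier → Series → Set ℓ
  IsStern s b = X S.* b S.≈ D s S.* expand b

  -- Compare coefficients of `x^(n+2)`. As b(x²) has no odd powers, for even `n` only the terms 1
  -- and x² of `D s` contribute, which is the odd recurrence; for odd `n` only s x does, which is
  -- the even recurrence.
  recurrence⇒IsStern : ∀ {s b} → b 0 ≈ 0# → (∀ n → b (2 ℕ.* n) ≈ s * b n) →
    (∀ n → b (suc (2 ℕ.* n)) ≈ b n + b (suc n)) → IsStern s b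
  recurrence⇒IsStern {s} {b} b₀≈0 b-even b-odd = coeffwise go
    where
    next : ∀ n → b (suc n) ≈ expand b (suc (suc n)) + (s * expand b (suc n) + expand b n)
    next n with even⊎odd n
    ... | k , inj₁ ≡.refl
      rewrite expand-even (b ∘ suc) k | expand-odd b k | expand-even b k =
      trans (b-odd k) (trans (+-comm _ _) (+-congˡ (sym
        (trans (+-congʳ (zeroʳ s)) (+-identityˡ _)))))
    ... | k , inj₂ ≡.refl
      rewrite expand-odd (b ∘ suc) k | expand-even (b ∘ suc) k | expand-odd b k =
      trans (reflexive (≡.cong b (≡.sym (ℕₚ.*-suc 2 k)))) (trans (b-even (suc k))
        (sym (trans (+-identityˡ _) (+-identityʳ _))))

    go : ∀ n → (X S.* b) n ≈ (D s S.* expand b) n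
    go 0 = trans (X-*-0 b) (sym (trans (D-*-0 s (expand b)) b₀≈0))
    go 1 = trans (X-* b 0) (trans b₀≈0 (sym (trans (D-*-1 s (expand b))
      (trans (+-identityˡ _) (trans (*-congˡ b₀≈0) (zeroʳ s))))))
    go (suc (suc n)) = trans (X-* b (suc n)) (trans (next n) (sym (D-* s (expand b) n)))

  D-cong : ∀ {s s′} → s ≈ s′ → D s S.≈ D s′
  D-cong s≈s′ = coeffwise λ where
    0             → refl
    1             → s≈s′
    (suc (suc n)) → refl

  IsStern-congˡ : ∀ {s s′ b} → s ≈ s′ → IsStern s b → IsStern s′ b
  IsStern-congˡ {s} {s′} {b} s≈s′ b-stern =
    SR.trans b-stern (SR.*-congʳ {expand b} {D s} {D s′} (D-cong s≈s′))

  module _ {s b} (b-stern : IsStern s b) where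
    IsStern⇒zero : b 0 ≈ 0#
    IsStern⇒zero = trans (sym (D-*-0 s (expand b))) (trans (sym (at b-stern 0)) (X-*-0 b))

    IsStern⇒recurrence : ∀ n →
      b (suc n) ≈ expand b (suc (suc n)) + (s * expand b (suc n) + expand b n)
    IsStern⇒recurrence n =
      trans (sym (X-* b (suc n))) (trans (at b-stern (suc (suc n))) (D-* s (expand b) n))

    -- Multiplying the functional equation by `u` cancels `D s`. The factor `X` stays and shifts the
    -- index by one, so the nonzero cases of (i) occur at odd `n`.
    reciprocal-*-stern : ∀ {u} → D s S.* u S.≈ S.1# → X S.* (b S.* u) S.≈ expand b
    reciprocal-*-stern {u} Du≈1 = begin
      X S.* (b S.* u)              ≈⟨ SR.*-assoc X b u ⟨
      X S.* b S.* u                ≈⟨ SR.*-congʳ b-stern ⟩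
      D s S.* expand b S.* u       ≈⟨ xy∙z≈y∙xz (D s) (expand b) u ⟩
      expand b S.* (D s S.* u)     ≈⟨ SR.*-congˡ {expand b} Du≈1 ⟩
      expand b S.* S.1#            ≈⟨ SR.*-identityʳ _ ⟩
      expand b                     ∎
      where open ≈ˢ-Reasoning

    -- Here `v` stands for x / `D s`, so a factor `X` appears on both sides and cancels; no shift of
    -- the index remains.
    X-reciprocal-*-stern : ∀ {v} → D s S.* v S.≈ X → v S.* b S.≈ expand b
    X-reciprocal-*-stern {v} Dv≈X = X-cancelˡ (begin
      X S.* (v S.* b)              ≈⟨ x∙yz≈y∙xz X v b ⟩
      v S.* (X S.* b)              ≈⟨ SR.*-congˡ {v} b-stern ⟩
      v S.* (D s S.* expand b)     ≈⟨ x∙yz≈yx∙z v (D s) (expand b) ⟩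
      D s S.* v S.* expand b       ≈⟨ SR.*-congʳ Dv≈X ⟩
      X S.* expand b               ∎)
      where open ≈ˢ-Reasoning

  private
    -- Substituting x² doubles the range of agreement, which is what lets the functional equation
    -- determine its solution.
    expand-cong-< : ∀ {f g m} n → (∀ {k} → k < m → f k ≈ g k) → n < m ℕ.+ m →
      expand f n ≈ expand g n
    expand-cong-< {f} {g} {m} n f≈g n<m+m with even⊎odd n
    ... | k , inj₁ ≡.refl rewrite expand-even f k | expand-even g k =
      f≈g (ℕₚ.*-cancelˡ-< 2 k m
        (≡.subst (2 ℕ.* k <_) (≡.cong (m ℕ.+_) (≡.sym (ℕₚ.+-identityʳ m))) n<m+m))
    ... | k , inj₂ ≡.refl rewrite expand-odd f k | expand-odd g k = refl

  -- For `n ≥ 2` the equation expresses `b n` by coefficients of b(x²) of index at most n + 1, hence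
  -- by values of `b` at indices up to (n + 1)/2 < n. For `n = 1` it reduces to `b 1 ≈ b 1` once
  -- `b 0` vanishes, so `b 1` has to be prescribed.
  IsStern-unique : ∀ {s b d} → IsStern s b → IsStern s d → b 1 ≈ d 1 → b S.≈ d
  IsStern-unique {s} {b} {d} b-stern d-stern b₁≈d₁ = coeffwise (<-rec _ step)
    where
    step : ∀ n → (∀ {k} → k < n → b k ≈ d k) → b n ≈ d n
    step zero          _  = trans (IsStern⇒zero b-stern) (sym (IsStern⇒zero d-stern))
    step (suc zero)    _  = b₁≈d₁
    step (suc (suc n)) ih = trans (IsStern⇒recurrence b-stern (suc n))
      (trans (+-cong (agree 3+n<4+2n) (+-cong (*-congˡ (agree 2+n<4+2n)) (agree 1+n<4+2n)))
        (sym (IsStern⇒recurrence d-stern (suc n))))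
      where
      agree : ∀ {k} → k < (2 ℕ.+ n) ℕ.+ (2 ℕ.+ n) → expand b k ≈ expand d k
      agree = expand-cong-< _ ih

      3+n<4+2n : 3 ℕ.+ n < (2 ℕ.+ n) ℕ.+ (2 ℕ.+ n)
      3+n<4+2n = s≤s (s≤s (ℕₚ.m≤n+m (2 ℕ.+ n) n))

      2+n<4+2n : 2 ℕ.+ n < (2 ℕ.+ n) ℕ.+ (2 ℕ.+ n)
      2+n<4+2n = ℕₚ.<-trans (ℕₚ.n<1+n (2 ℕ.+ n)) 3+n<4+2n

      1+n<4+2n : 1 ℕ.+ n < (2 ℕ.+ n) ℕ.+ (2 ℕ.+ n)
      1+n<4+2n = ℕₚ.<-trans (ℕₚ.n<1+n (1 ℕ.+ n)) 2+n<4+2n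

  stern-*-stern : ∀ {s b b⁻ d} → IsStern s b → IsStern (- s) b⁻ → IsStern (1# + 1# - s ^ 2) d →
    b 1 ≈ 1# → b⁻ 1 ≈ 1# → d 1 ≈ 1# → b S.* b⁻ S.≈ expand d
  stern-*-stern {s} {b} {b⁻} {d} b-stern b⁻-stern d-stern b₁≈1 b⁻₁≈1 d₁≈1 =
    SR.trans g≈expand-h (expand-cong (IsStern-unique h-stern d-stern (trans h₁≈1 (sym d₁≈1))))
    where
    q : Carrier
    q = 1# + 1# - s ^ 2

    g h : Series
    g   = b S.* b⁻
    -- `h` is `D q S.* g` divided by x. By `X²g` the series x² g(x) is `D q S.* g` with x²
    -- substituted for x; dividing by x² gives g(x) = h(x²).
    h n = (D q S.* g) (suc n)

    X²g : X S.* (X S.* g) S.≈ expand (D q S.* g)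
    X²g = begin
      X S.* (X S.* (b S.* b⁻))
        ≈⟨ ˢ.solve 3 (λ x b b⁻ → x ˢ.:* (x ˢ.:* (b ˢ.:* b⁻)) ˢ.:= x ˢ.:* b ˢ.:* (x ˢ.:* b⁻))
             SR.refl X b b⁻ ⟩
      X S.* b S.* (X S.* b⁻)
        ≈⟨ SR.*-cong b-stern b⁻-stern ⟩
      D s S.* expand b S.* (D (- s) S.* expand b⁻)
        ≈⟨ ˢ.solve 4 (λ d e d⁻ e⁻ → d ˢ.:* e ˢ.:* (d⁻ ˢ.:* e⁻) ˢ.:= d ˢ.:* d⁻ ˢ.:* (e ˢ.:* e⁻))
             SR.refl (D s) (expand b) (D (- s)) (expand b⁻) ⟩
      D s S.* D (- s) S.* (expand b S.* expand b⁻)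
        ≈⟨ SR.*-cong (expand-D s) (expand-* b b⁻) ⟨
      expand (D q) S.* expand g
        ≈⟨ expand-* (D q) g ⟨
      expand (D q S.* g) ∎
      where open ≈ˢ-Reasoning

    g≈expand-h : g S.≈ expand h
    g≈expand-h = coeffwise λ n →
      trans (sym (trans (X-* (X S.* g) (suc n)) (X-* g n))) (at X²g (suc (suc n)))

    g₀≈0 : g 0 ≈ 0#
    g₀≈0 = trans (+-identityʳ _) (trans (*-congʳ (IsStern⇒zero b-stern)) (zeroˡ _))

    h-stern : IsStern q h
    -- Forming `h` discards the constant coefficient of `D q S.* g`; `X S.* h` recovers that product
    -- because this coefficient vanishes, by `g₀≈0`.
    h-stern = SR.trans (coeffwise λ where
        zero    → trans (X-*-0 h) (sym (trans (D-*-0 q g) g₀≈0))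
        (suc n) → X-* h n)
      (SR.*-congˡ {D q} g≈expand-h)

    h₁≈1 : h 1 ≈ 1#
    h₁≈1 = begin
      h 1
        -- `h 1` is the coefficient of x² in g; of its three products only `b 1 * b⁻ 1` survives,
        -- since `b 0` and `b⁻ 0` vanish.
        ≈⟨ at g≈expand-h 2 ⟨
      b 0 * b⁻ 2 + (b 1 * b⁻ 1 + (b 2 * b⁻ 0 + 0#))
        ≈⟨ +-cong (trans (*-congʳ (IsStern⇒zero b-stern)) (zeroˡ _))
             (+-cong (trans (*-cong b₁≈1 b⁻₁≈1) (*-identityˡ 1#))
               (trans (+-identityʳ _) (trans (*-congˡ (IsStern⇒zero b⁻-stern)) (zeroʳ _)))) ⟩
      0# + (1# + 0#)
        ≈⟨ trans (+-identityˡ _) (+-identityʳ 1#) ⟩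
      1# ∎
      where open ≈-Reasoning

  -- Binet's formula.

  ^-inverse : ∀ {p r} → p * r ≈ 1# → ∀ n → p ^ n * r ^ n ≈ 1#
  ^-inverse pr≈1 zero    = *-identityˡ 1#
  ^-inverse {p} {r} pr≈1 (suc n) = trans
    (solve 4 (λ p r P Q → p :* P :* (r :* Q) := p :* r :* (P :* Q)) refl p r (p ^ n) (r ^ n))
    (trans (*-cong pr≈1 (^-inverse pr≈1 n)) (*-identityˡ 1#))

  -- When p r = 1, x / (1 - (p + r) x + x²) = ∑ₙ (pⁿ - rⁿ) / (p - r) xⁿ, and κ = 1 / (p - r).
  module _ {p r κ} (pr≈1 : p * r ≈ 1#) (κ[p²-1]≈p : κ * (p ^ 2 - 1#) ≈ p) where
    binet : Series
    binet n = κ * (p ^ n - r ^ n)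

    D-*-binet : D (- p - r) S.* binet S.≈ X
    D-*-binet = coeffwise go
      where
      open ≈-Reasoning

      binet₀≈0 : binet 0 ≈ 0#
      binet₀≈0 = trans (*-congˡ (-‿inverseʳ 1#)) (zeroʳ κ)

      binet₁≈1 : binet 1 ≈ 1#
      binet₁≈1 = begin
        -- A factor `p * r` is inserted before `p`, so that `r` can be pulled out and p² - 1
        -- appears, to which the hypothesis on `κ` applies.
        κ * (p * 1# - r * 1#)              ≈⟨ *-congˡ (+-congʳ (*-identityˡ (p * 1#))) ⟨
        κ * (1# * (p * 1#) - r * 1#)       ≈⟨ *-congˡ (+-congʳ (*-congʳ pr≈1)) ⟨
        κ * (p * r * (p * 1#) - r * 1#)
          ≈⟨ solve 4 (λ κ p r o →
               κ :* (p :* r :* (p :* o) :- r :* o) := r :* (κ :* (p :* (p :* o) :- o)))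
               refl κ p r 1# ⟩
        r * (κ * (p ^ 2 - 1#))             ≈⟨ *-congˡ κ[p²-1]≈p ⟩
        r * p                              ≈⟨ trans (*-comm r p) pr≈1 ⟩
        1#                                 ∎

      go : ∀ n → (D (- p - r) S.* binet) n ≈ X n
      go 0 = trans (D-*-0 (- p - r) binet) binet₀≈0
      go 1 = trans (D-*-1 (- p - r) binet)
        (trans (+-cong binet₁≈1 (trans (*-congˡ binet₀≈0) (zeroʳ _))) (+-identityʳ 1#))
      go (suc (suc n)) = trans (D-* (- p - r) binet n) (begin
        binet (suc (suc n)) + ((- p - r) * binet (suc n) + binet n)
          -- Powers of `p` and of `r` satisfy the recurrence with characteristic polynomial y² - (p
          -- + r) y + p r. The constant term of `D` is 1 instead of `p * r`, and their difference is
          -- what remains.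
          ≈⟨ solve 5 (λ κ p r P Q →
               κ :* (p :* (p :* P) :- r :* (r :* Q))
                 :+ ((:- p :- r) :* (κ :* (p :* P :- r :* Q)) :+ κ :* (P :- Q))
                 := κ :* (P :- Q) :- p :* r :* (κ :* (P :- Q))) refl κ p r (p ^ n) (r ^ n) ⟩
        binet n - p * r * binet n
          ≈⟨ +-congˡ (-‿cong (trans (*-congʳ pr≈1) (*-identityˡ _))) ⟩
        binet n - binet n
          ≈⟨ -‿inverseʳ (binet n) ⟩
        0# ∎)

-- Images of the Stern polynomials as solutions of the functional equation.

module _ (R : CommutativeRing c ℓ) where
  open CommutativeRing R
  open SternSeries R
  open IntegerCoefficients R using (⟨⟩-isRingHomomorphism)
  open RingNotation R using (_⟨_⟩)

  module _ {φ : ℤ[t].Poly → Carrier}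
    (φ-homo : IsRingHomomorphism (CommutativeRing.rawRing ℤ[t].commutativeRing) rawRing φ)
    where
    open IsRingHomomorphism φ-homo

    -- An arbitrary homomorphism covers both evaluation at a point and the identity map, which (ii)
    -- needs for its unevaluated factor.
    B-isStern : IsStern (φ ℤ[t].t) (φ ∘ B)
    B-isStern = recurrence⇒IsStern 0#-homo even odd
      where
      even : ∀ n → φ (B (2 ℕ.* n)) ≈ φ ℤ[t].t * φ (B n)
      -- The recurrences of `B` start at `n = 1`; the case `n = 0` holds because `B 0` is zero.
      even zero      = trans 0#-homo (sym (trans (*-congˡ 0#-homo) (zeroʳ _)))
      even n@(suc _) = trans (reflexive (≡.cong φ (B-even n (s≤s z≤n)))) (*-homo ℤ[t].t (B n))

      odd : ∀ n → φ (B (suc (2 ℕ.* n))) ≈ φ (B n) + φ (B (suc n))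
      odd zero      = sym (trans (+-congʳ 0#-homo) (+-identityˡ _))
      odd n@(suc _) = begin
        φ (B (suc (2 ℕ.* n)))          ≡⟨ ≡.cong (φ ∘ B) (ℕₚ.+-comm (2 ℕ.* n) 1) ⟨
        φ (B (2 ℕ.* n ℕ.+ 1))          ≡⟨ ≡.cong φ (B-odd n (s≤s z≤n)) ⟩
        φ (B n ℤ[t].+ B (n ℕ.+ 1))     ≈⟨ +-homo (B n) (B (n ℕ.+ 1)) ⟩
        φ (B n) + φ (B (n ℕ.+ 1))      ≡⟨ ≡.cong (λ k → φ (B n) + φ (B k)) (ℕₚ.+-comm n 1) ⟩
        φ (B n) + φ (B (suc n))        ∎
        where open SetoidReasoning setoid

  B⟨⟩-isStern : ∀ s → IsStern s (λ n → B n ⟨ s ⟩)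
  B⟨⟩-isStern s = IsStern-congˡ t⟨s⟩≈s (B-isStern (⟨⟩-isRingHomomorphism s))
    where
    t⟨s⟩≈s : ℤ[t].t ⟨ s ⟩ ≈ s
    t⟨s⟩≈s = trans (+-identityˡ _) (trans (*-congˡ 1#-homo) (*-identityʳ s))
      where open IsRingHomomorphism (⟨⟩-isRingHomomorphism s)

  B⟨⟩-1 : ∀ s → B 1 ⟨ s ⟩ ≈ 1#
  B⟨⟩-1 s = IsRingHomomorphism.1#-homo (⟨⟩-isRingHomomorphism s)

-- Identity (i): the Chebyshev polynomials at -t/2.

module _ where
  open ℚ[t]
  open SternSeries commutativeRing
  open IntegerCoefficients commutativeRing using (⟨⟩-isRingHomomorphism)
  private
    module R = CommutativeRing commutativeRing
    module S = PowerSeries commutativeRing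
    module SR = CommutativeRing S.commutativeRing

    y : Carrier
    y = - (C ½ * t)

    open IsRingHomomorphism (⟨⟩-isRingHomomorphism y)

  -- Replacing t by -t/2 turns the Chebyshev denominator 1 - 2 t x + x² into 1 + t x + x².
  D-*-U : D t S.* (λ n → U n ⟨ y ⟩) S.≈ S.1#
  D-*-U = begin
    D t S.* (λ n → U n ⟨ y ⟩)
      ≈⟨ SR.*-congʳ {λ n → U n ⟨ y ⟩} (S.coeffwise denominator) ⟨
    (λ n → chebyshevDenominator n ⟨ y ⟩) S.* (λ n → U n ⟨ y ⟩)
      ≈⟨ series-*-homo {R = ℤ[t].commutativeRing} (⟨⟩-isRingHomomorphism y) chebyshevDenominator U ⟨
    (λ n → (chebyshevDenominator ℤ[t]⟦x⟧.* U) n ⟨ y ⟩)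
      ≈⟨ S.coeffwise (λ n → ⟦⟧-cong {_} {ℤ[t]⟦x⟧.1# n} (ℤ[t]⟦x⟧.at U-generatingFunction n)) ⟩
    (λ n → ℤ[t]⟦x⟧.1# n ⟨ y ⟩)
      ≈⟨ S.coeffwise one ⟩
    S.1# ∎
    where
    open SetoidReasoning SR.setoid

    one : ∀ n → ℤ[t]⟦x⟧.1# n ⟨ y ⟩ ≈ S.1# n
    one zero    = 1#-homo
    one (suc n) = R.refl

    denominator : ∀ n → chebyshevDenominator n ⟨ y ⟩ ≈ D t n
    denominator 0 = 1#-homo
    -- Evaluation leaves a trailing zero in the list, so the two sides are compared coefficientwise,
    -- by computation with rationals.
    denominator 1 = ℚ[t].coeffwise λ where
      0 → ≡.refl
      1 → ≡.refl
      2 → ≡.refl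
      (suc (suc (suc n))) → ≡.refl
    denominator 2 = 1#-homo
    denominator (suc (suc (suc n))) = R.refl

  chebyshev-identity : ∀ n →
    ∑[ i ≤ n ] (B (toℕ i) ⟨ t ⟩ * U (n ∸ toℕ i) ⟨ - (C ½ * t) ⟩)
      ≈ (if does (2 ∣? n) then 0# else B ((n ℕ.+ 1) ℕ./ 2) ⟨ t ⟩)
  chebyshev-identity n = begin
    (b S.* u) n
      ≈⟨ X-* (b S.* u) n ⟨
    (X S.* (b S.* u)) (suc n)
      ≈⟨ S.at (reciprocal-*-stern (B⟨⟩-isStern commutativeRing t) D-*-U) (suc n) ⟩
    expand b (suc n)
      ≡⟨ odd-part≡expand-suc b n ⟨
    (if does (2 ∣? n) then 0# else b ((n ℕ.+ 1) ℕ./ 2)) ∎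
    where
    open SetoidReasoning R.setoid

    b u : S.Series
    b k = B k ⟨ t ⟩
    u k = U k ⟨ y ⟩

-- Identity (ii): the product of the series at t and -t.

module _ where
  open ℤ[t]
  open SternSeries commutativeRing
  private
    module R = CommutativeRing commutativeRing
    module S = PowerSeries commutativeRing

  negation-identity : ∀ n →
    ∑[ i ≤ n ] (B (toℕ i) * B (n ∸ toℕ i) ⟨ - t ⟩)
      ≈ (if does (2 ∣? n) then B (n ℕ./ 2) ⟨ C (+ 2) - t ^ 2 ⟩ else 0#)
  negation-identity n = R.trans
    (S.at (stern-*-stern
      (B-isStern commutativeRing (Identity.isRingHomomorphism R.rawRing R.refl))
      -- The required parameter `1# + 1# - t ^ 2` agrees with `C (+ 2) - t ^ 2` by computation.
      (B⟨⟩-isStern commutativeRing (- t)) (B⟨⟩-isStern commutativeRing (C (+ 2) - t ^ 2))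
      R.refl (B⟨⟩-1 commutativeRing (- t)) (B⟨⟩-1 commutativeRing (C (+ 2) - t ^ 2))) n)
    (R.reflexive (≡.sym (even-part≡expand (λ k → B k ⟨ C (+ 2) - t ^ 2 ⟩) n)))

-- Identity (iii): Binet's formula with p = t² and r = t⁻².

module _ (R : CommutativeRing c ℓ) where
  open CommutativeRing R
  open SternSeries R
  open RingNotation R using (_^_; _⟨_⟩; sum⁺-syntax)
  open Exp semiring using (^-assocʳ)
  open Sum semiring using (*-distribˡ-sum; sum-cong-≋)
  open SetoidReasoning setoid
  private
    module S = PowerSeries R

    inverse-unique : ∀ {x y z} → x * y ≈ 1# → x * z ≈ 1# → y ≈ z
    inverse-unique {x} {y} {z} xy≈1 xz≈1 = begin
      y              ≈⟨ *-identityʳ y ⟨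
      y * 1#         ≈⟨ *-congˡ xz≈1 ⟨
      y * (x * z)    ≈⟨ *-assoc y x z ⟨
      y * x * z      ≈⟨ *-congʳ (trans (*-comm y x) xy≈1) ⟩
      1# * z         ≈⟨ *-identityˡ z ⟩
      z              ∎

  -- The quotients enter as elements `r`, `κ` and `t⁻²ⁱ i` known only through their defining
  -- products, which keeps fractions out of the calculation.
  binet-identity : ∀ t r κ (t⁻²ⁱ : ℕ → Carrier) → t ^ 2 * r ≈ 1# → κ * (t ^ 4 - 1#) ≈ t ^ 2 →
    (∀ i → t ^ (2 ℕ.* i) * t⁻²ⁱ i ≈ 1#) → ∀ n →
    κ * ∑[ i ≤ n ] ((t ^ (2 ℕ.* toℕ i) - t⁻²ⁱ (toℕ i)) * B (n ∸ toℕ i) ⟨ - (t ^ 2) - r ⟩)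
      ≈ (if does (2 ∣? n) then B (n ℕ./ 2) ⟨ - (t ^ 2) - r ⟩ else 0#)
  binet-identity t r κ t⁻²ⁱ pr≈1 κ[t⁴-1]≈p inverse n = begin
    κ * ∑[ i ≤ n ] (w (toℕ i) * b (n ∸ toℕ i))
      ≈⟨ *-distribˡ-sum {suc n} κ (λ i → w (toℕ i) * b (n ∸ toℕ i)) ⟩
    ∑[ i ≤ n ] (κ * (w (toℕ i) * b (n ∸ toℕ i)))
      ≈⟨ sum-cong-≋ {suc n} (λ i → trans (sym (*-assoc κ (w (toℕ i)) (b (n ∸ toℕ i))))
           (*-congʳ {b (n ∸ toℕ i)} (κw≈binet (toℕ i)))) ⟩
    (binet pr≈1 κ[p²-1]≈p S.* b) n
      ≈⟨ S.at (X-reciprocal-*-stern (B⟨⟩-isStern R (- p - r)) (D-*-binet pr≈1 κ[p²-1]≈p)) n ⟩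
    expand b n
      ≡⟨ even-part≡expand b n ⟨
    (if does (2 ∣? n) then b (n ℕ./ 2) else 0#) ∎
    where
    p : Carrier
    p = t ^ 2

    w b : S.Series
    w i = t ^ (2 ℕ.* i) - t⁻²ⁱ i
    b k = B k ⟨ - p - r ⟩

    κ[p²-1]≈p : κ * (p ^ 2 - 1#) ≈ p
    κ[p²-1]≈p = trans (*-congˡ (+-congʳ (^-assocʳ t 2 2))) κ[t⁴-1]≈p

    κw≈binet : ∀ i → κ * w i ≈ binet pr≈1 κ[p²-1]≈p i
    -- `t⁻²ⁱ i` and `r ^ i` are both inverse to `t ^ (2 ℕ.* i)`, hence equal.
    κw≈binet i = *-congˡ (+-cong (sym (^-assocʳ t 2 i)) (-‿cong
      (inverse-unique (inverse i) (trans (*-congʳ (sym (^-assocʳ t 2 i))) (^-inverse pr≈1 i)))))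

theorem3p6 : (n : ℕ) →
    (let open ℚ[t] in
    ∑[ i ≤ n ] (B (toℕ i) ⟨ t ⟩ * U (n ∸ toℕ i) ⟨ - (C ½ * t) ⟩)
    ≈ (if does (2 ∣? n) then 0# else B ((n ℕ.+ 1) ℕ./ 2) ⟨ t ⟩))
    ×
    (let open ℤ[t] in
    ∑[ i ≤ n ] (B (toℕ i) * B (n ∸ toℕ i) ⟨ - t ⟩)
    ≈ (if does (2 ∣? n) then B (n ℕ./ 2) ⟨ C (+ 2) - t ^ 2 ⟩ else 0#))
    ×
    (let open ℚ⟨t⟩ in
    ((t ^ 2) / (t ^ 4 - 1#) [ t^4-1≉0 ])
    * ∑[ i ≤ n ] ((t ^ (2 ℕ.* toℕ i) - 1# / (t ^ (2 ℕ.* toℕ i)) [ t^n≉0 (2 ℕ.* toℕ i) ])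
    * B (n ∸ toℕ i) ⟨ - (t ^ 2) - 1# / (t ^ 2) [ t^n≉0 2 ] ⟩)
    ≈ (if does (2 ∣? n) then B (n ℕ./ 2) ⟨ - (t ^ 2) - 1# / (t ^ 2) [ t^n≉0 2 ] ⟩ else 0#))
theorem3p6 n =
  chebyshev-identity n ,
  negation-identity n ,
  binet-identity commutativeRing t
    (1# / (t ^ 2) [ t^n≉0 2 ])
    ((t ^ 2) / (t ^ 4 - 1#) [ t^4-1≉0 ])
    (λ i → 1# / (t ^ (2 ℕ.* i)) [ t^n≉0 (2 ℕ.* i) ])
    (*-inverse (t ^ 2) (t^n≉0 2))
    (/-*-cancel (t ^ 2) (t ^ 4 - 1#) t^4-1≉0)
    (λ i → *-inverse (t ^ (2 ℕ.* i)) (t^n≉0 (2 ℕ.* i)))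
    n
  where
  open ℚ⟨t⟩

  *-inverse : ∀ x (x≉0 : ¬ x ≈ 0#) → x * (1# / x [ x≉0 ]) ≈ 1#
  *-inverse x x≉0 = R.trans {x * 1/x} {1/x * x} (R.*-comm x 1/x) (/-*-cancel 1# x x≉0)
    where
    module R = CommutativeRing commutativeRing
    1/x = 1# / x [ x≉0 ]
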